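{- Let $\Pi$ be a strongly antisymmetric linear $m$-scheme on $S\subseteq V$. Let $k,m'\in[m]$, $A\in\Pi^{(k)}$ and $A'=\sigma_k(A)$, such that $m\ge 2km'$ and $\sigma_k|_A:A\to A'$ is bijective. For $i\in[m']$ let $\sigma_k^{(i)}:V^{ki}\to V^i$ send $(x_1,\dots,x_i)$ (with $x_1,\dots,x_i\in V^k$) to $(\sigma_k(x_1),\dots,\sigma_k(x_i))$, and let $\Pi'^{(i)}:=\{\sigma_k^{(i)}(B):B\in\Pi^{(ki)},B\subseteq A^i\}$. Then $\Pi'=\{\Pi'^{(1)},\dots,\Pi'^{(m')}\}$ is a well-defined strongly antisymmetric linear $m'$-scheme on $A'$ (in particular each $\Pi'^{(i)}$ is a partition of $A'^i$). Moreover, for $i\in[m']$ and $B\in\Pi^{(ki)}$ with $B\subseteq A^i$, the map $\sigma_k^{(i)}|_B:B\to\sigma_k^{(i)}(B)$ is bijective.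
   Context: $V$ is a finite-dimensional vector space over a finite field $\mathbb{F}$. $\sigma_k:V^k\to V$ is $(x_1,\dots,x_k)\mapsto x_1+\dots+x_k$. $\mathcal{M}_{k,k'}$ is the set of maps $V^k\to V^{k'}$, $(x_1,\dots,x_k)\mapsto(\sum_i c_{i,1}x_i,\dots,\sum_i c_{i,k'}x_i)$, $c_{i,j}\in\mathbb{F}$. A linear $m$-scheme on a set $T\subseteq V$ is $\Pi=\{\Pi^{(1)},\dots,\Pi^{(m)}\}$ with $\Pi^{(k)}$ a partition of $T^k$ such that for all $k,k'\in[m]$, $B\in\Pi^{(k)}$, $B'\in\Pi^{(k')}$, $\tau\in\mathcal{M}_{k,k'}$: (P1) $\tau(B)=B'$ or $\tau(B)\cap B'=\emptyset$; (P2) $\#\{x\in B:\tau(x)=y\}$ is constant for $y\in B'$. It is strongly antisymmetric if no nontrivial permutation of a block of any $\Pi^{(k)}$ is a composition of bijections $\tau|_{B}:B\to B'$ between blocks ($\tau\in\mathcal{M}_{k,k'}$) and their inverses. -}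

module Defs where

open import Level using (0ℓ)
open import Data.Nat using (ℕ; zero; suc; _+_; _*_; _≤_)
open import Data.Fin using (Fin)
open import Data.Vec using (Vec; []; _∷_; map; zipWith; foldr; tabulate; replicate; splitAt)
open import Data.Vec.Relation.Unary.All using (All)
open import Data.Bool using (Bool; true)
open import Data.Product using (Σ; ∃; _×_; _,_)
open import Data.Sum using (_⊎_)
open import Data.Empty using (⊥)
open import Relation.Nullary using (¬_)
open import Relation.Binary.PropositionalEquality using (_≡_)
open import Algebra.Structures using (IsCommutativeRing)
open import Function.Bundles using (_↔_; _⇔_)

record FiniteField : Set₁ where
  field
    Carrier : Set
    _+F_ _*F_ : Carrier → Carrier → Carrier
    -F_ : Carrier → Carrier
    0F 1F : Carrier
    isCommutativeRing : IsCommutativeRing _≡_ _+F_ _*F_ -F_ 0F 1F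
    0≢1 : ¬ (0F ≡ 1F)
    inverse : ∀ x → ¬ (x ≡ 0F) → Σ Carrier (λ y → x *F y ≡ 1F)
    size : ℕ
    enumeration : Fin size ↔ Carrier

-- Everything below: V = F^d (any finite-dimensional F-vector space is
-- linearly isomorphic to some F^d, and all notions are linear-invariant).

module Scheme (𝔽 : FiniteField) (d : ℕ) where
  open FiniteField 𝔽

  V : Set
  V = Vec Carrier d

  0V : V
  0V = replicate d 0F

  _+V_ : V → V → V
  _+V_ = zipWith _+F_

  _·V_ : Carrier → V → V
  c ·V v = map (c *F_) v

  Tuple : ℕ → Set
  Tuple k = Vec V k

  σ : ∀ {k} → Tuple k → V
  σ = foldr _ _+V_ 0V

  Coef : ℕ → ℕ → Set
  Coef k k' = Fin k → Fin k' → Carrier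

  -- the map τ_c ∈ M_{k,k'} : (x_i)_i ↦ (Σ_i c_{i,j} x_i)_j
  τ : ∀ {k k'} → Coef k k' → Tuple k → Tuple k'
  τ {k} c x = tabulate (λ j → σ (zipWith _·V_ (tabulate (λ i → c i j)) x))

  Subset : ℕ → Set
  Subset k = Tuple k → Bool

  _∈_ : ∀ {k} → Tuple k → Subset k → Set
  x ∈ B = B x ≡ true

  Img : ∀ {k k'} → (Tuple k → Tuple k') → Subset k → Tuple k' → Set
  Img f B y = Σ (Tuple _) (λ x → x ∈ B × f x ≡ y)

  Fibre : ∀ {k k'} → (Tuple k → Tuple k') → Subset k → Tuple k' → Set
  Fibre f B y = Σ (Tuple _) (λ x → x ∈ B × f x ≡ y)

  _≐_ : ∀ {k} → Subset k → (Tuple k → Set) → Set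
  B ≐ P = ∀ y → (y ∈ B) ⇔ P y

  -- a collection of subsets of V^k, for each k (Π^{(k)} ; only k ∈ [m] matters)
  Collection : Set₁
  Collection = (k : ℕ) → Subset k → Set

  _^ᵗ_∋_ : (V → Set) → (k : ℕ) → Tuple k → Set
  T ^ᵗ k ∋ x = All T x

  IsPartition : (T : V → Set) (k : ℕ) → (Subset k → Set) → Set
  IsPartition T k P =
      (∀ B → P B → Σ (Tuple k) (λ x → x ∈ B))
    × (∀ B → P B → ∀ x → x ∈ B → T ^ᵗ k ∋ x)
    × (∀ x → T ^ᵗ k ∋ x → Σ (Subset k) (λ B → P B × x ∈ B))
    × (∀ B B' → P B → P B' → ∀ x → x ∈ B → x ∈ B' → ∀ y → (y ∈ B) ⇔ (y ∈ B'))

  InRange : ℕ → ℕ → Set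
  InRange m k = 1 ≤ k × k ≤ m

  BijOn : ∀ {k} {Y : Set} → (Tuple k → Y) → Subset k → (Y → Set) → Set
  BijOn f B C =
      (∀ x → x ∈ B → C (f x))
    × (∀ x x' → x ∈ B → x' ∈ B → f x ≡ f x' → x ≡ x')
    × (∀ y → C y → Σ (Tuple _) (λ x → x ∈ B × f x ≡ y))

  IsLinearScheme : ℕ → (V → Set) → Collection → Set
  IsLinearScheme m T Π =
      (∀ k → InRange m k → IsPartition T k (Π k))
    × (∀ k k' → InRange m k → InRange m k' → ∀ B B' → Π k B → Π k' B' →
         ∀ (c : Coef k k') →
           ( (B' ≐ Img (τ c) B) ⊎ (∀ y → Img (τ c) B y → y ∈ B' → ⊥) )
         × (∀ y y' → y ∈ B' → y' ∈ B' → Fibre (τ c) B y ↔ Fibre (τ c) B y'))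

  -- formal compositions of bijections τ|_B : B → B' between blocks and
  -- their inverses, starting at block B (level k)
  module _ (m : ℕ) (Π : Collection) where

    data Chain {k : ℕ} (B : Subset k) : (k' : ℕ) → Subset k' → Set where
      nil : Chain B k B
      fwd : ∀ {k' k''} {B' : Subset k'} {B'' : Subset k''} →
            Chain B k' B' → InRange m k'' → Π k'' B'' → (c : Coef k' k'') →
            BijOn (τ c) B' (_∈ B'') → Chain B k'' B''
      bwd : ∀ {k' k''} {B' : Subset k'} {B'' : Subset k''} →
            Chain B k' B' → InRange m k'' → Π k'' B'' → (c : Coef k'' k') →
            BijOn (τ c) B'' (_∈ B') → Chain B k'' B''

    data Graph {k : ℕ} {B : Subset k} : ∀ {k'} {B' : Subset k'} →
               Chain B k' B' → Tuple k → Tuple k' → Set where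
      gnil : ∀ {x} → Graph nil x x
      gfwd : ∀ {k' k''} {B' : Subset k'} {B'' : Subset k''}
               {ch : Chain B k' B'} {r : InRange m k''} {p : Π k'' B''}
               {c : Coef k' k''} {b : BijOn (τ c) B' (_∈ B'')} {x y} →
             Graph ch x y → Graph (fwd ch r p c b) x (τ c y)
      gbwd : ∀ {k' k''} {B' : Subset k'} {B'' : Subset k''}
               {ch : Chain B k' B'} {r : InRange m k''} {p : Π k'' B''}
               {c : Coef k'' k'} {b : BijOn (τ c) B'' (_∈ B')} {x y z} →
             Graph ch x y → z ∈ B'' → τ c z ≡ y → Graph (bwd ch r p c b) x z

    StronglyAntisymmetric : Set
    StronglyAntisymmetric =
      ∀ k (B : Subset k) → InRange m k → Π k B → (ch : Chain B k B) →
        ∀ x y → x ∈ B → Graph ch x y → x ≡ y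

  chunks : ∀ i k → Tuple (i * k) → Vec (Tuple k) i
  chunks zero k x = []
  chunks (suc i) k x with splitAt k x
  ... | (y , z , _) = y ∷ chunks i k z

  σ⁽_⁾ : ∀ i {k} → Tuple (i * k) → Tuple i
  σ⁽ i ⁾ {k} x = map σ (chunks i k x)

  InPow : ∀ {k} (A : Subset k) (i : ℕ) → Tuple (i * k) → Set
  InPow {k} A i x = All (_∈ A) (chunks i k x)

  σImage : ∀ {k} → Subset k → V → Set
  σImage A v = Σ (Tuple _) (λ a → a ∈ A × σ a ≡ v)

  Induced : (Π : Collection) {k : ℕ} (A : Subset k) → Collection
  Induced Π {k} A i S =
    Σ (Subset (i * k)) (λ B → Π (i * k) B × (∀ x → x ∈ B → InPow A i x)
                              × (S ≐ Img (σ⁽ i ⁾) B))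

module Submission where

-- Tuples in A^i are identified with their images under σ⁽ⁱ⁾, which is injective there because σ is
-- injective on A, so the blocks of Π^(ik) inside A^i become the blocks of Π′^(i). To compare levels
-- i₁ and i₂ through τ_c one works at level i₁k + i₂k ≤ 2km′ ≤ m with the pairs (x , z) such that
-- τ_c (σ x) = σ z. A block containing one such pair consists of such pairs: adding the defect
-- τ_c (σ x) − σ z to one coordinate of each k-chunk of z is a linear retraction onto these pairs
-- which fixes the given pair, so by (P1) it maps the block onto itself. Projecting these blocks
-- onto their two halves gives (P1) and (P2) for Π′, and lifts every chain of block bijections of Π′
-- to one of Π, so strong antisymmetry passes from Π to Π′.

open import Defs
open import Level using (0ℓ)
open import Data.Nat using (ℕ; zero; suc; _+_; _*_; _≤_)
import Data.Nat.Properties as ℕ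
open import Data.Nat.Tactic.RingSolver using (solve-∀)
open import Data.Fin as Fin using (Fin; zero; suc; _↑ˡ_; _↑ʳ_)
import Data.Fin.Properties as Fin
open import Data.Vec as Vec using (Vec; []; _∷_; _++_; map; zipWith; replicate; lookup; tabulate)
import Data.Vec.Properties as Vec
open import Data.Vec.Relation.Unary.All as All using (All; []; _∷_)
import Data.Vec.Relation.Unary.All.Properties as Allₚ
open import Data.List as List using (List; []; _∷_)
open import Data.List.Relation.Unary.Any as Any using (Any; here; there)
open import Data.List.Membership.Propositional using () renaming (_∈_ to _∈ˡ_)
open import Data.List.Membership.Propositional.Properties using (∈-map⁺; ∈-allFin; ∈-cartesianProductWith⁺)
open import Data.Bool as Bool using (Bool; true; false; if_then_else_)
import Data.Bool.Properties as Bool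
open import Data.Product using (Σ; _×_; _,_; proj₁; proj₂)
open import Data.Sum using (_⊎_; inj₁; inj₂)
open import Data.Empty using (⊥; ⊥-elim)
open import Relation.Nullary using (Dec; yes; no; does; contradiction)
open import Relation.Nullary.Decidable using (via-injection; ⌊_⌋; _×-dec_; toWitness; fromWitness)
open import Relation.Unary using (Decidable)
open import Relation.Binary.Definitions using (DecidableEquality)
open import Relation.Binary.PropositionalEquality
open import Axiom.UniquenessOfIdentityProofs using (UIP; module Decidable⇒UIP)
open import Algebra.Bundles using (CommutativeMonoid)
open import Algebra.Structures using (IsCommutativeRing)
import Algebra.Properties.CommutativeMonoid.Sum as Sum
open import Function.Bundles using (Inverse; Equivalence; _↔_; _⇔_; mk↔ₛ′; mk⇔)
open import Function.Properties.Inverse using (↔⇒↣)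
open import Function.Construct.Symmetry using (↔-sym)
open import Function.Construct.Composition using (_↔-∘_)

m*o+n*o≤2*o*p : ∀ {m n o p} → m ≤ p → n ≤ p → m * o + n * o ≤ 2 * o * p
m*o+n*o≤2*o*p {m} {n} {o} {p} m≤p n≤p = begin
  m * o + n * o  ≤⟨ ℕ.+-mono-≤ (ℕ.*-monoˡ-≤ o m≤p) (ℕ.*-monoˡ-≤ o n≤p) ⟩
  p * o + p * o  ≡⟨ twice o p ⟩
  2 * o * p      ∎
  where
  open ℕ.≤-Reasoning
  twice : ∀ o p → p * o + p * o ≡ 2 * o * p
  twice = solve-∀

module VectorSpaces (𝔽 : FiniteField) where
  open FiniteField 𝔽

  record VectorSpace : Set₁ where
    infixl 6 _⊕_
    infixr 7 _⊙_
    field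
      X : Set
      _⊕_ : X → X → X
      _⊙_ : Carrier → X → X
      𝟎 : X
      ⊕-assoc : ∀ u v w → (u ⊕ v) ⊕ w ≡ u ⊕ (v ⊕ w)
      ⊕-comm : ∀ u v → u ⊕ v ≡ v ⊕ u
      ⊕-identityˡ : ∀ u → 𝟎 ⊕ u ≡ u
      ⊙-distribˡ : ∀ a u v → a ⊙ (u ⊕ v) ≡ a ⊙ u ⊕ a ⊙ v
      ⊙-distribʳ : ∀ a b u → (a +F b) ⊙ u ≡ a ⊙ u ⊕ b ⊙ u
      ⊙-assoc : ∀ a b u → (a *F b) ⊙ u ≡ a ⊙ (b ⊙ u)
      ⊙-identityˡ : ∀ u → 1F ⊙ u ≡ u
      ⊙-zeroˡ : ∀ u → 0F ⊙ u ≡ 𝟎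

  δ : ∀ {n} → Fin n → Fin n → Carrier
  δ i a = if does (i Fin.≟ a) then 1F else 0F

  δ-refl : ∀ {n} (a : Fin n) → δ a a ≡ 1F
  δ-refl a with a Fin.≟ a
  ... | yes _ = refl
  ... | no a≢a = ⊥-elim (a≢a refl)

  δ-≢ : ∀ {n} {i a : Fin n} → i ≢ a → δ i a ≡ 0F
  δ-≢ {i = i} {a} i≢a with i Fin.≟ a
  ... | yes i≡a = ⊥-elim (i≢a i≡a)
  ... | no _ = refl

  scalars : VectorSpace
  scalars = record
    { X = Carrier ; _⊕_ = _+F_ ; _⊙_ = _*F_ ; 𝟎 = 0F
    ; ⊕-assoc = +-assoc ; ⊕-comm = +-comm ; ⊕-identityˡ = +-identityˡ
    ; ⊙-distribˡ = distribˡ ; ⊙-distribʳ = λ a b u → distribʳ u a b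
    ; ⊙-assoc = *-assoc ; ⊙-identityˡ = *-identityˡ ; ⊙-zeroˡ = zeroˡ }
    where open IsCommutativeRing isCommutativeRing

  pointwise : VectorSpace → ℕ → VectorSpace
  pointwise W n = record
    { X = Vec X n ; _⊕_ = zipWith _⊕_ ; _⊙_ = λ a → map (a ⊙_) ; 𝟎 = replicate n 𝟎
    ; ⊕-assoc = Vec.zipWith-assoc ⊕-assoc
    ; ⊕-comm = Vec.zipWith-comm ⊕-comm
    ; ⊕-identityˡ = Vec.zipWith-identityˡ ⊕-identityˡ
    ; ⊙-distribˡ = distribˡ ; ⊙-distribʳ = distribʳ ; ⊙-assoc = assoc
    ; ⊙-identityˡ = identityˡ ; ⊙-zeroˡ = zeroˡ }
    where
    open VectorSpace W
    distribˡ : ∀ {n} a (u v : Vec X n) → map (a ⊙_) (zipWith _⊕_ u v) ≡ zipWith _⊕_ (map (a ⊙_) u) (map (a ⊙_) v)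
    distribˡ a [] [] = refl
    distribˡ a (x ∷ u) (y ∷ v) = cong₂ _∷_ (⊙-distribˡ a x y) (distribˡ a u v)
    distribʳ : ∀ {n} a b (u : Vec X n) → map ((a +F b) ⊙_) u ≡ zipWith _⊕_ (map (a ⊙_) u) (map (b ⊙_) u)
    distribʳ a b [] = refl
    distribʳ a b (x ∷ u) = cong₂ _∷_ (⊙-distribʳ a b x) (distribʳ a b u)
    assoc : ∀ {n} a b (u : Vec X n) → map ((a *F b) ⊙_) u ≡ map (a ⊙_) (map (b ⊙_) u)
    assoc a b [] = refl
    assoc a b (x ∷ u) = cong₂ _∷_ (⊙-assoc a b x) (assoc a b u)
    identityˡ : ∀ {n} (u : Vec X n) → map (1F ⊙_) u ≡ u
    identityˡ [] = refl
    identityˡ (x ∷ u) = cong₂ _∷_ (⊙-identityˡ x) (identityˡ u)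
    zeroˡ : ∀ {n} (u : Vec X n) → map (0F ⊙_) u ≡ replicate n 𝟎
    zeroˡ [] = refl
    zeroˡ (x ∷ u) = cong₂ _∷_ (⊙-zeroˡ x) (zeroˡ u)

  module VectorSpaceProperties (W : VectorSpace) where
    open VectorSpace W public
    open IsCommutativeRing isCommutativeRing using (zeroʳ; -‿inverseʳ)
    open ≡-Reasoning

    ⊕-identityʳ : ∀ u → u ⊕ 𝟎 ≡ u
    ⊕-identityʳ u = trans (⊕-comm u 𝟎) (⊕-identityˡ u)

    ⊙-zeroʳ : ∀ a → a ⊙ 𝟎 ≡ 𝟎
    ⊙-zeroʳ a = begin
      a ⊙ 𝟎          ≡⟨ cong (a ⊙_) (⊙-zeroˡ 𝟎) ⟨
      a ⊙ (0F ⊙ 𝟎)    ≡⟨ ⊙-assoc a 0F 𝟎 ⟨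
      (a *F 0F) ⊙ 𝟎  ≡⟨ cong (_⊙ 𝟎) (zeroʳ a) ⟩
      0F ⊙ 𝟎         ≡⟨ ⊙-zeroˡ 𝟎 ⟩
      𝟎              ∎

    infixl 6 _⊖_
    _⊖_ : X → X → X
    u ⊖ v = u ⊕ (-F 1F) ⊙ v

    ⊖-self : ∀ u → u ⊖ u ≡ 𝟎
    ⊖-self u = begin
      u ⊕ (-F 1F) ⊙ u          ≡⟨ cong (_⊕ (-F 1F) ⊙ u) (⊙-identityˡ u) ⟨
      1F ⊙ u ⊕ (-F 1F) ⊙ u     ≡⟨ ⊙-distribʳ 1F (-F 1F) u ⟨
      (1F +F (-F 1F)) ⊙ u      ≡⟨ cong (_⊙ u) (-‿inverseʳ 1F) ⟩
      0F ⊙ u                  ≡⟨ ⊙-zeroˡ u ⟩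
      𝟎                       ∎

    ⊕-⊖-cancel : ∀ u v → u ⊕ (v ⊖ u) ≡ v
    ⊕-⊖-cancel u v = begin
      u ⊕ (v ⊕ (-F 1F) ⊙ u)    ≡⟨ cong (u ⊕_) (⊕-comm v _) ⟩
      u ⊕ ((-F 1F) ⊙ u ⊕ v)    ≡⟨ ⊕-assoc u _ v ⟨
      (u ⊖ u) ⊕ v             ≡⟨ cong (_⊕ v) (⊖-self u) ⟩
      𝟎 ⊕ v                   ≡⟨ ⊕-identityˡ v ⟩
      v                       ∎

    ⊕-commutativeMonoid : CommutativeMonoid 0ℓ 0ℓ
    ⊕-commutativeMonoid = record
      { Carrier = X ; _≈_ = _≡_ ; _∙_ = _⊕_ ; ε = 𝟎
      ; isCommutativeMonoid = record
        { isMonoid = record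
          { isSemigroup = record
            { isMagma = record { isEquivalence = isEquivalence ; ∙-cong = cong₂ _⊕_ }
            ; assoc = ⊕-assoc }
          ; identity = ⊕-identityˡ , ⊕-identityʳ }
        ; comm = ⊕-comm } }

    open Sum ⊕-commutativeMonoid public
      using (sum; sum-cong-≗; ∑-distrib-+; ∑-comm; sum-replicate-zero)

    ⊙-distribˡ-sum : ∀ {n} a (f : Fin n → X) → a ⊙ sum f ≡ sum (λ i → a ⊙ f i)
    ⊙-distribˡ-sum {zero} a f = ⊙-zeroʳ a
    ⊙-distribˡ-sum {suc n} a f = trans (⊙-distribˡ a _ _) (cong (a ⊙ f zero ⊕_) (⊙-distribˡ-sum a (λ i → f (suc i))))

    sum-zero : ∀ {n} {f : Fin n → X} → (∀ i → f i ≡ 𝟎) → sum f ≡ 𝟎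
    sum-zero {n} f≗𝟎 = trans (sum-cong-≗ f≗𝟎) (sum-replicate-zero n)

    sum-δ : ∀ {n} (a : Fin n) (f : Fin n → X) → sum (λ i → δ i a ⊙ f i) ≡ f a
    sum-δ {suc n} zero f = begin
      1F ⊙ f zero ⊕ sum (λ i → 0F ⊙ f (suc i))
        ≡⟨ cong₂ _⊕_ (⊙-identityˡ (f zero)) (sum-zero (λ i → ⊙-zeroˡ (f (suc i)))) ⟩
      f zero ⊕ 𝟎                                ≡⟨ ⊕-identityʳ (f zero) ⟩
      f zero                                    ∎
    sum-δ {suc n} (suc a) f = begin
      0F ⊙ f zero ⊕ sum (λ i → δ i a ⊙ f (suc i))  ≡⟨ cong₂ _⊕_ (⊙-zeroˡ (f zero)) (sum-δ a (λ i → f (suc i))) ⟩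
      𝟎 ⊕ f (suc a)                                ≡⟨ ⊕-identityˡ (f (suc a)) ⟩
      f (suc a)                                    ∎

module _ (𝔽 : FiniteField) (d : ℕ) where
  open FiniteField 𝔽
  open Scheme 𝔽 d
  open VectorSpaces 𝔽
  open ≡-Reasoning

  -- The operations of 𝕍 are definitionally _+V_, _·V_ and 0V.
  module 𝔽ˢ = VectorSpaceProperties scalars
  module 𝕍 = VectorSpaceProperties (pointwise scalars d)
  module 𝕋 {n : ℕ} = VectorSpaceProperties (pointwise (pointwise scalars d) n)
  open 𝕋

  lookup-ext : ∀ {A : Set} {n} {u v : Vec A n} → (∀ i → lookup u i ≡ lookup v i) → u ≡ v
  lookup-ext {u = u} {v} p = begin
    u                   ≡⟨ Vec.tabulate∘lookup u ⟨
    tabulate (lookup u) ≡⟨ Vec.tabulate-cong p ⟩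
    tabulate (lookup v) ≡⟨ Vec.tabulate∘lookup v ⟩
    v                   ∎

  lookup-⊕ : ∀ {n} (u v : Tuple n) i → lookup (u ⊕ v) i ≡ lookup u i +V lookup v i
  lookup-⊕ u v i = Vec.lookup-zipWith _+V_ i u v

  lookup-⊙ : ∀ {n} a (u : Tuple n) i → lookup (a ⊙ u) i ≡ a ·V lookup u i
  lookup-⊙ a u i = Vec.lookup-map i (a ·V_) u

  lookup-𝟎 : ∀ {n} i → lookup (𝟎 {n}) i ≡ 0V
  lookup-𝟎 i = Vec.lookup-replicate i 0V

  lookup-sum : ∀ {k n} (f : Fin k → Tuple n) j → lookup (sum f) j ≡ 𝕍.sum (λ b → lookup (f b) j)
  lookup-sum {zero} f j = lookup-𝟎 j
  lookup-sum {suc k} f j =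
    trans (lookup-⊕ (f zero) _ j) (cong (lookup (f zero) j +V_) (lookup-sum (λ b → f (suc b)) j))

  σ-sum : ∀ {n} (v : Tuple n) → σ v ≡ 𝕍.sum (lookup v)
  σ-sum [] = refl
  σ-sum (x ∷ v) = cong (x +V_) (σ-sum v)

  ·V-distribʳ-sum : ∀ {n} (f : Fin n → Carrier) (v : V) → 𝔽ˢ.sum f ·V v ≡ 𝕍.sum (λ j → f j ·V v)
  ·V-distribʳ-sum {zero} f v = 𝕍.⊙-zeroˡ v
  ·V-distribʳ-sum {suc n} f v =
    trans (𝕍.⊙-distribʳ (f zero) _ v) (cong ((f zero ·V v) +V_) (·V-distribʳ-sum (λ j → f (suc j)) v))

  lookup-τ : ∀ {a b} (c : Coef a b) (x : Tuple a) j → lookup (τ c x) j ≡ 𝕍.sum (λ i → c i j ·V lookup x i)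
  lookup-τ c x j = begin
    lookup (τ c x) j                                           ≡⟨ Vec.lookup∘tabulate _ j ⟩
    σ (zipWith _·V_ (tabulate (λ i → c i j)) x)                ≡⟨ σ-sum (zipWith _·V_ (tabulate (λ i → c i j)) x) ⟩
    𝕍.sum (lookup (zipWith _·V_ (tabulate (λ i → c i j)) x))   ≡⟨ 𝕍.sum-cong-≗ entry ⟩
    𝕍.sum (λ i → c i j ·V lookup x i)                          ∎
    where
    entry : ∀ i → lookup (zipWith _·V_ (tabulate (λ i → c i j)) x) i ≡ c i j ·V lookup x i
    entry i = trans (Vec.lookup-zipWith _·V_ i (tabulate (λ i → c i j)) x)
                    (cong (_·V lookup x i) (Vec.lookup∘tabulate (λ i → c i j) i))

  -- The maps in 𝓜

  ℳ : ∀ {a b} → (Tuple a → Tuple b) → Set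
  ℳ {a} {b} f = Σ (Coef a b) λ c → ∀ x → τ c x ≡ f x

  lookup-ℳ : ∀ {a b} {f : Tuple a → Tuple b} (ℳf : ℳ f) x j →
             lookup (f x) j ≡ 𝕍.sum (λ i → proj₁ ℳf i j ·V lookup x i)
  lookup-ℳ (c , τc≗f) x j = trans (cong (λ y → lookup y j) (sym (τc≗f x))) (lookup-τ c x j)

  ℳ-intro : ∀ {a b} {f : Tuple a → Tuple b} (c : Coef a b) →
            (∀ x j → lookup (f x) j ≡ 𝕍.sum (λ i → c i j ·V lookup x i)) → ℳ f
  ℳ-intro c f-coords = c , λ x → lookup-ext λ j → trans (lookup-τ c x j) (sym (f-coords x j))

  ℳ-cong : ∀ {a b} {f g : Tuple a → Tuple b} → ℳ f → (∀ x → f x ≡ g x) → ℳ g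
  ℳ-cong (c , τc≗f) f≗g = c , λ x → trans (τc≗f x) (f≗g x)

  ℳ-select : ∀ {a b} (g : Fin b → Fin a) → ℳ (λ x → tabulate (λ j → lookup x (g j)))
  ℳ-select g = ℳ-intro (λ i j → δ i (g j)) λ x j →
    trans (Vec.lookup∘tabulate _ j) (sym (𝕍.sum-δ (g j) (lookup x)))

  ℳ-id : ∀ {a} → ℳ {a} (λ x → x)
  ℳ-id = ℳ-cong (ℳ-select (λ j → j)) Vec.tabulate∘lookup

  ℳ-𝟎 : ∀ {a b} → ℳ {a} {b} (λ _ → 𝟎)
  ℳ-𝟎 = ℳ-intro (λ _ _ → 0F) λ x j →
    trans (lookup-𝟎 j) (sym (𝕍.sum-zero (λ i → 𝕍.⊙-zeroˡ (lookup x i))))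

  ℳ-⊕ : ∀ {a b} {f g : Tuple a → Tuple b} → ℳ f → ℳ g → ℳ (λ x → f x ⊕ g x)
  ℳ-⊕ {f = f} {g} ℳf@(c , _) ℳg@(c′ , _) = ℳ-intro (λ i j → c i j +F c′ i j) λ x j → begin
    lookup (f x ⊕ g x) j
      ≡⟨ lookup-⊕ (f x) (g x) j ⟩
    lookup (f x) j +V lookup (g x) j
      ≡⟨ cong₂ _+V_ (lookup-ℳ ℳf x j) (lookup-ℳ ℳg x j) ⟩
    𝕍.sum (λ i → c i j ·V lookup x i) +V 𝕍.sum (λ i → c′ i j ·V lookup x i)
      ≡⟨ 𝕍.∑-distrib-+ (λ i → c i j ·V lookup x i) (λ i → c′ i j ·V lookup x i) ⟨
    𝕍.sum (λ i → (c i j ·V lookup x i) +V (c′ i j ·V lookup x i))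
      ≡⟨ 𝕍.sum-cong-≗ (λ i → 𝕍.⊙-distribʳ _ _ (lookup x i)) ⟨
    𝕍.sum (λ i → (c i j +F c′ i j) ·V lookup x i) ∎

  ℳ-⊙ : ∀ {a b} {f : Tuple a → Tuple b} e → ℳ f → ℳ (λ x → e ⊙ f x)
  ℳ-⊙ {f = f} e ℳf@(c , _) = ℳ-intro (λ i j → e *F c i j) λ x j → begin
    lookup (e ⊙ f x) j                          ≡⟨ lookup-⊙ e (f x) j ⟩
    e ·V lookup (f x) j                         ≡⟨ cong (e ·V_) (lookup-ℳ ℳf x j) ⟩
    e ·V 𝕍.sum (λ i → c i j ·V lookup x i)      ≡⟨ 𝕍.⊙-distribˡ-sum e (λ i → c i j ·V lookup x i) ⟩
    𝕍.sum (λ i → e ·V (c i j ·V lookup x i))    ≡⟨ 𝕍.sum-cong-≗ (λ i → 𝕍.⊙-assoc e (c i j) (lookup x i)) ⟨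
    𝕍.sum (λ i → (e *F c i j) ·V lookup x i)    ∎

  ℳ-∘ : ∀ {a b e} {f : Tuple a → Tuple b} {g : Tuple b → Tuple e} → ℳ f → ℳ g → ℳ (λ x → g (f x))
  ℳ-∘ {f = f} {g} ℳf@(c , _) ℳg@(c′ , _) = ℳ-intro (λ i l → 𝔽ˢ.sum (λ j → c′ j l *F c i j)) λ x l → begin
    lookup (g (f x)) l                                          ≡⟨ lookup-ℳ ℳg (f x) l ⟩
    𝕍.sum (λ j → c′ j l ·V lookup (f x) j)
      ≡⟨ 𝕍.sum-cong-≗ (λ j → cong (c′ j l ·V_) (lookup-ℳ ℳf x j)) ⟩
    𝕍.sum (λ j → c′ j l ·V 𝕍.sum (λ i → c i j ·V lookup x i))
      ≡⟨ 𝕍.sum-cong-≗ (λ j → 𝕍.⊙-distribˡ-sum (c′ j l) (λ i → c i j ·V lookup x i)) ⟩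
    𝕍.sum (λ j → 𝕍.sum (λ i → c′ j l ·V (c i j ·V lookup x i)))
      ≡⟨ 𝕍.∑-comm (λ j i → c′ j l ·V (c i j ·V lookup x i)) ⟩
    𝕍.sum (λ i → 𝕍.sum (λ j → c′ j l ·V (c i j ·V lookup x i)))
      ≡⟨ 𝕍.sum-cong-≗ (λ i → 𝕍.sum-cong-≗ (λ j → 𝕍.⊙-assoc (c′ j l) (c i j) (lookup x i))) ⟨
    𝕍.sum (λ i → 𝕍.sum (λ j → (c′ j l *F c i j) ·V lookup x i))
      ≡⟨ 𝕍.sum-cong-≗ (λ i → ·V-distribʳ-sum (λ j → c′ j l *F c i j) (lookup x i)) ⟨
    𝕍.sum (λ i → 𝔽ˢ.sum (λ j → c′ j l *F c i j) ·V lookup x i) ∎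

  ℳ-sum : ∀ {k a b} (f : Fin k → Tuple a → Tuple b) → (∀ i → ℳ (f i)) → ℳ (λ x → sum (λ i → f i x))
  ℳ-sum {zero} f ℳf = ℳ-𝟎
  ℳ-sum {suc k} f ℳf = ℳ-⊕ (ℳf zero) (ℳ-sum (λ i → f (suc i)) (λ i → ℳf (suc i)))

  ℳ-homo-⊕ : ∀ {a b} {f : Tuple a → Tuple b} → ℳ f → ∀ u v → f (u ⊕ v) ≡ f u ⊕ f v
  ℳ-homo-⊕ {f = f} ℳf@(c , _) u v = lookup-ext λ j → begin
    lookup (f (u ⊕ v)) j
      ≡⟨ lookup-ℳ ℳf (u ⊕ v) j ⟩
    𝕍.sum (λ i → c i j ·V lookup (u ⊕ v) i)
      ≡⟨ 𝕍.sum-cong-≗ (λ i → trans (cong (c i j ·V_) (lookup-⊕ u v i)) (𝕍.⊙-distribˡ _ _ _)) ⟩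
    𝕍.sum (λ i → (c i j ·V lookup u i) +V (c i j ·V lookup v i))
      ≡⟨ 𝕍.∑-distrib-+ (λ i → c i j ·V lookup u i) (λ i → c i j ·V lookup v i) ⟩
    𝕍.sum (λ i → c i j ·V lookup u i) +V 𝕍.sum (λ i → c i j ·V lookup v i)
      ≡⟨ cong₂ _+V_ (lookup-ℳ ℳf u j) (lookup-ℳ ℳf v j) ⟨
    lookup (f u) j +V lookup (f v) j
      ≡⟨ lookup-⊕ (f u) (f v) j ⟨
    lookup (f u ⊕ f v) j ∎

  ℳ-homo-𝟎 : ∀ {a b} {f : Tuple a → Tuple b} → ℳ f → f 𝟎 ≡ 𝟎
  ℳ-homo-𝟎 {f = f} ℳf@(c , _) = lookup-ext λ j → begin
    lookup (f 𝟎) j                          ≡⟨ lookup-ℳ ℳf 𝟎 j ⟩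
    𝕍.sum (λ i → c i j ·V lookup 𝟎 i)       ≡⟨ 𝕍.sum-zero (λ i → trans (cong (c i j ·V_) (lookup-𝟎 i)) (𝕍.⊙-zeroʳ _)) ⟩
    0V                                      ≡⟨ lookup-𝟎 j ⟨
    lookup 𝟎 j                              ∎

  BijOn-ℳ : ∀ {a b} {f : Tuple a → Tuple b} (ℳf : ℳ f) {B : Subset a} {C : Tuple b → Set} →
            BijOn f B C → BijOn (τ (proj₁ ℳf)) B C
  BijOn-ℳ {f = f} (c , τc≗f) {C = C} (into , injective , onto) =
      (λ x x∈B → subst C (sym (τc≗f x)) (into x x∈B))
    , (λ x x′ x∈B x′∈B eq → injective x x′ x∈B x′∈B (trans (sym (τc≗f x)) (trans eq (τc≗f x′))))
    , (λ y y∈C → let x , x∈B , fx≡y = onto y y∈C in x , x∈B , trans (τc≗f x) fx≡y)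

  -- Chunks, halves and embeddings of tuples

  concat-chunks : ∀ i k (x : Tuple (i * k)) → Vec.concat (chunks i k x) ≡ x
  concat-chunks zero k [] = refl
  concat-chunks (suc i) k x with Vec.splitAt k x
  concat-chunks (suc i) k .(y ++ z) | y , z , refl = cong (y ++_) (concat-chunks i k z)

  chunks-concat : ∀ i k (v : Vec (Tuple k) i) → chunks i k (Vec.concat v) ≡ v
  chunks-concat zero k [] = refl
  chunks-concat (suc i) k (y ∷ v) with Vec.splitAt k (y ++ Vec.concat v)
  ... | y′ , z′ , y++v≡y′++z′ with Vec.++-injective y y′ y++v≡y′++z′
  ... | refl , refl = cong (y ∷_) (chunks-concat i k v)

  chunk : ∀ {i k} → Fin i → Tuple (i * k) → Tuple k
  chunk j x = tabulate (λ b → lookup x (Fin.combine j b))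

  lookup-chunks : ∀ i k (x : Tuple (i * k)) j → lookup (chunks i k x) j ≡ chunk j x
  lookup-chunks i k x j = lookup-ext λ b → begin
    lookup (lookup (chunks i k x) j) b
      ≡⟨ Vec.lookup-concat (chunks i k x) j b ⟨
    lookup (Vec.concat (chunks i k x)) (Fin.combine j b)
      ≡⟨ cong (λ y → lookup y (Fin.combine j b)) (concat-chunks i k x) ⟩
    lookup x (Fin.combine j b)
      ≡⟨ Vec.lookup∘tabulate _ b ⟨
    lookup (chunk j x) b ∎

  lookup-σ⁽⁾ : ∀ i {k} (x : Tuple (i * k)) j → lookup (σ⁽ i ⁾ x) j ≡ 𝕍.sum (λ b → lookup x (Fin.combine j b))
  lookup-σ⁽⁾ i {k} x j = begin
    lookup (map σ (chunks i k x)) j                       ≡⟨ Vec.lookup-map j σ (chunks i k x) ⟩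
    σ (lookup (chunks i k x) j)                           ≡⟨ cong σ (lookup-chunks i k x j) ⟩
    σ (chunk j x)                                         ≡⟨ σ-sum (chunk j x) ⟩
    𝕍.sum (lookup (chunk j x))                            ≡⟨ 𝕍.sum-cong-≗ (Vec.lookup∘tabulate entry) ⟩
    𝕍.sum (λ b → lookup x (Fin.combine j b))              ∎
    where
    entry : Fin k → V
    entry b = lookup x (Fin.combine j b)

  ℳ-σ⁽⁾ : ∀ i k → ℳ (σ⁽ i ⁾ {k})
  ℳ-σ⁽⁾ i k = ℳ-cong (ℳ-sum column (λ b → ℳ-select (λ j → Fin.combine j b))) λ x → lookup-ext λ j → begin
    lookup (sum (λ b → column b x)) j
      ≡⟨ lookup-sum (λ b → column b x) j ⟩
    𝕍.sum (λ b → lookup (column b x) j)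
      ≡⟨ 𝕍.sum-cong-≗ (λ b → Vec.lookup∘tabulate (λ j′ → lookup x (Fin.combine j′ b)) j) ⟩
    𝕍.sum (λ b → lookup x (Fin.combine j b))
      ≡⟨ lookup-σ⁽⁾ i x j ⟨
    lookup (σ⁽ i ⁾ x) j ∎
    where
    column : Fin k → Tuple (i * k) → Tuple i
    column b x = tabulate (λ j → lookup x (Fin.combine j b))

  module _ {m n : ℕ} where
    lookup-take : ∀ (w : Tuple (m + n)) i → lookup (Vec.take m w) i ≡ lookup w (i ↑ˡ n)
    lookup-take w i = trans (sym (Vec.lookup-++ˡ (Vec.take m w) (Vec.drop m w) i))
                            (cong (λ y → lookup y (i ↑ˡ n)) (Vec.take++drop≡id m w))

    lookup-drop : ∀ (w : Tuple (m + n)) i → lookup (Vec.drop m w) i ≡ lookup w (m ↑ʳ i)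
    lookup-drop w i = trans (sym (Vec.lookup-++ʳ (Vec.take m w) (Vec.drop m w) i))
                            (cong (λ y → lookup y (m ↑ʳ i)) (Vec.take++drop≡id m w))

    ℳ-take : ℳ (Vec.take m {n})
    ℳ-take = ℳ-cong (ℳ-select (_↑ˡ n)) λ w → lookup-ext λ i →
      trans (Vec.lookup∘tabulate _ i) (sym (lookup-take w i))

    ℳ-drop : ℳ (Vec.drop m {n})
    ℳ-drop = ℳ-cong (ℳ-select (m ↑ʳ_)) λ w → lookup-ext λ i →
      trans (Vec.lookup∘tabulate _ i) (sym (lookup-drop w i))

    take-++ : ∀ (x : Tuple m) (z : Tuple n) → Vec.take m (x ++ z) ≡ x
    take-++ x z = Vec.++-injectiveˡ (Vec.take m (x ++ z)) x (Vec.take++drop≡id m (x ++ z))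

    drop-++ : ∀ (x : Tuple m) (z : Tuple n) → Vec.drop m (x ++ z) ≡ z
    drop-++ x z = Vec.++-injectiveʳ (Vec.take m (x ++ z)) x (Vec.take++drop≡id m (x ++ z))

    take-drop-injective : ∀ {w w′ : Tuple (m + n)} →
                          Vec.take m w ≡ Vec.take m w′ → Vec.drop m w ≡ Vec.drop m w′ → w ≡ w′
    take-drop-injective {w} {w′} t≡ d≡ = begin
      w                               ≡⟨ Vec.take++drop≡id m w ⟨
      Vec.take m w ++ Vec.drop m w    ≡⟨ cong₂ _++_ t≡ d≡ ⟩
      Vec.take m w′ ++ Vec.drop m w′  ≡⟨ Vec.take++drop≡id m w′ ⟩
      w′                              ∎

  scatter : ∀ {a b} → (Fin a → Fin b) → Tuple a → Tuple b
  scatter g = τ (λ i a → δ (g i) a)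

  module _ {a b} {g : Fin a → Fin b} where
    lookup-scatter-image : (∀ {i j} → g i ≡ g j → i ≡ j) → ∀ x i → lookup (scatter g x) (g i) ≡ lookup x i
    lookup-scatter-image g-injective x i =
      trans (lookup-τ _ x (g i)) (trans (𝕍.sum-cong-≗ coefficient) (𝕍.sum-δ i (lookup x)))
      where
      coefficient : ∀ j → δ (g j) (g i) ·V lookup x j ≡ δ j i ·V lookup x j
      coefficient j with j Fin.≟ i
      ... | yes refl = cong (_·V lookup x j) (δ-refl (g j))
      ... | no j≢i = cong (_·V lookup x j) (δ-≢ (λ gj≡gi → j≢i (g-injective gj≡gi)))

    lookup-scatter-outside : ∀ {p} → (∀ j → g j ≢ p) → ∀ x → lookup (scatter g x) p ≡ 0V
    lookup-scatter-outside {p} p∉img x = trans (lookup-τ _ x p)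
      (𝕍.sum-zero (λ j → trans (cong (_·V lookup x j) (δ-≢ (p∉img j))) (𝕍.⊙-zeroˡ (lookup x j))))

  ↑ˡ≢↑ʳ : ∀ {m n} (i : Fin m) (j : Fin n) → i ↑ˡ n ≢ m ↑ʳ j
  ↑ˡ≢↑ʳ zero j ()
  ↑ˡ≢↑ʳ (suc i) j eq = ↑ˡ≢↑ʳ i j (Fin.suc-injective eq)

  module Embedding (n₁ i k : ℕ) (o : Fin k) where
    embed : Tuple i → Tuple (n₁ + i * k)
    embed = scatter (λ j → n₁ ↑ʳ Fin.combine j o)

    ℳ-embed : ℳ embed
    ℳ-embed = _ , λ _ → refl

    take-embed : ∀ v → Vec.take n₁ (embed v) ≡ 𝟎
    take-embed v = lookup-ext λ b → begin
      lookup (Vec.take n₁ (embed v)) b  ≡⟨ lookup-take (embed v) b ⟩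
      lookup (embed v) (b ↑ˡ i * k)     ≡⟨ lookup-scatter-outside (λ j eq → ↑ˡ≢↑ʳ b _ (sym eq)) v ⟩
      0V                                ≡⟨ lookup-𝟎 b ⟨
      lookup 𝟎 b                        ∎

    σ⁽⁾-drop-embed : ∀ v → σ⁽ i ⁾ (Vec.drop n₁ (embed v)) ≡ v
    σ⁽⁾-drop-embed v = lookup-ext λ j → begin
      lookup (σ⁽ i ⁾ (Vec.drop n₁ (embed v))) j                       ≡⟨ lookup-σ⁽⁾ i _ j ⟩
      𝕍.sum (λ b → lookup (Vec.drop n₁ (embed v)) (Fin.combine j b))
        ≡⟨ 𝕍.sum-cong-≗ (λ b → trans (lookup-drop {n₁} (embed v) (Fin.combine j b)) (entry j b)) ⟩
      𝕍.sum (λ b → δ b o ·V lookup v j)                               ≡⟨ 𝕍.sum-δ o (λ _ → lookup v j) ⟩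
      lookup v j                                                      ∎
      where
      position-injective : ∀ {j j′} → n₁ ↑ʳ Fin.combine j o ≡ n₁ ↑ʳ Fin.combine j′ o → j ≡ j′
      position-injective eq = Fin.combine-injectiveˡ _ o _ o (Fin.↑ʳ-injective n₁ _ _ eq)
      entry : ∀ j b → lookup (embed v) (n₁ ↑ʳ Fin.combine j b) ≡ δ b o ·V lookup v j
      entry j b with b Fin.≟ o
      ... | yes refl = trans (lookup-scatter-image position-injective v j) (sym (𝕍.⊙-identityˡ (lookup v j)))
      ... | no b≢o = trans (lookup-scatter-outside outside v) (sym (𝕍.⊙-zeroˡ (lookup v j)))
        where
        outside : ∀ j′ → n₁ ↑ʳ Fin.combine j′ o ≢ n₁ ↑ʳ Fin.combine j b
        outside j′ eq = b≢o (sym (Fin.combine-injectiveʳ j′ o j b (Fin.↑ʳ-injective n₁ _ _ eq)))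

  module Retraction {a p} {t₁ t₂ : Tuple a → Tuple p} {E : Tuple p → Tuple a}
                    (ℳt₁ : ℳ t₁) (ℳt₂ : ℳ t₂) (ℳE : ℳ E)
                    (t₁∘E≡𝟎 : ∀ v → t₁ (E v) ≡ 𝟎) (t₂∘E≡id : ∀ v → t₂ (E v) ≡ v) where
    retract : Tuple a → Tuple a
    retract w = w ⊕ E (t₁ w ⊖ t₂ w)

    ℳ-retract : ℳ retract
    ℳ-retract = ℳ-⊕ ℳ-id (ℳ-∘ (ℳ-⊕ ℳt₁ (ℳ-⊙ (-F 1F) ℳt₂)) ℳE)

    t₁-retract : ∀ w → t₁ (retract w) ≡ t₁ w
    t₁-retract w = begin
      t₁ (w ⊕ E (t₁ w ⊖ t₂ w))        ≡⟨ ℳ-homo-⊕ ℳt₁ w _ ⟩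
      t₁ w ⊕ t₁ (E (t₁ w ⊖ t₂ w))     ≡⟨ cong (t₁ w ⊕_) (t₁∘E≡𝟎 _) ⟩
      t₁ w ⊕ 𝟎                        ≡⟨ ⊕-identityʳ (t₁ w) ⟩
      t₁ w                            ∎

    t₂-retract : ∀ w → t₂ (retract w) ≡ t₁ w
    t₂-retract w = begin
      t₂ (w ⊕ E (t₁ w ⊖ t₂ w))        ≡⟨ ℳ-homo-⊕ ℳt₂ w _ ⟩
      t₂ w ⊕ t₂ (E (t₁ w ⊖ t₂ w))     ≡⟨ cong (t₂ w ⊕_) (t₂∘E≡id _) ⟩
      t₂ w ⊕ (t₁ w ⊖ t₂ w)            ≡⟨ ⊕-⊖-cancel (t₂ w) (t₁ w) ⟩
      t₁ w                            ∎

    retract-equalizes : ∀ w → t₁ (retract w) ≡ t₂ (retract w)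
    retract-equalizes w = trans (t₁-retract w) (sym (t₂-retract w))

    retract-fixes : ∀ w → t₁ w ≡ t₂ w → retract w ≡ w
    retract-fixes w t₁w≡t₂w = begin
      w ⊕ E (t₁ w ⊖ t₂ w)             ≡⟨ cong (λ u → w ⊕ E (u ⊖ t₂ w)) t₁w≡t₂w ⟩
      w ⊕ E (t₂ w ⊖ t₂ w)             ≡⟨ cong (λ u → w ⊕ E u) (⊖-self (t₂ w)) ⟩
      w ⊕ E 𝟎                         ≡⟨ cong (w ⊕_) (ℳ-homo-𝟎 ℳE) ⟩
      w ⊕ 𝟎                           ≡⟨ ⊕-identityʳ w ⟩
      w                               ∎

  -- Finiteness

  _≟F_ : DecidableEquality Carrier
  _≟F_ = via-injection (↔⇒↣ (↔-sym enumeration)) Fin._≟_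

  _≟ᵀ_ : ∀ {n} → DecidableEquality (Tuple n)
  _≟ᵀ_ = Vec.≡-dec (Vec.≡-dec _≟F_)

  ≡-irrelevantᵀ : ∀ {n} → UIP (Tuple n)
  ≡-irrelevantᵀ = Decidable⇒UIP.≡-irrelevant _≟ᵀ_

  ≡-irrelevantᴮ : UIP Bool
  ≡-irrelevantᴮ = Decidable⇒UIP.≡-irrelevant Bool._≟_

  fibre-≡ : ∀ {a q} {P : Tuple a → Set} → (∀ {x} (p p′ : P x) → p ≡ p′) →
            ∀ {f : Tuple a → Tuple q} {y} {u v : Σ (Tuple a) (λ x → P x × f x ≡ y)} → proj₁ u ≡ proj₁ v → u ≡ v
  fibre-≡ P-irrelevant {u = x , p , e} {.x , p′ , e′} refl =
    cong₂ (λ p e → x , p , e) (P-irrelevant p p′) (≡-irrelevantᵀ e e′)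

  allScalars : List Carrier
  allScalars = List.map (Inverse.to enumeration) (List.allFin size)

  ∈-allScalars : ∀ a → a ∈ˡ allScalars
  ∈-allScalars a = Any.map (λ a≡ → trans (sym (Inverse.strictlyInverseˡ enumeration a)) a≡)
                        (∈-map⁺ (Inverse.to enumeration) (∈-allFin (Inverse.from enumeration a)))

  allVectors : ∀ {A : Set} → List A → (n : ℕ) → List (Vec A n)
  allVectors as zero = [] ∷ []
  allVectors as (suc n) = List.cartesianProductWith _∷_ as (allVectors as n)

  ∈-allVectors : ∀ {A : Set} {as : List A} → (∀ a → a ∈ˡ as) → ∀ {n} (v : Vec A n) → v ∈ˡ allVectors as n
  ∈-allVectors ∈as [] = here refl
  ∈-allVectors ∈as (a ∷ v) = ∈-cartesianProductWith⁺ _∷_ (∈as a) (∈-allVectors ∈as v)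

  allTuples : ∀ n → List (Tuple n)
  allTuples n = allVectors (allVectors allScalars d) n

  ∈-allTuples : ∀ {n} (x : Tuple n) → x ∈ˡ allTuples n
  ∈-allTuples = ∈-allVectors (∈-allVectors ∈-allScalars)

  ∃? : ∀ {n} {P : Tuple n → Set} → Decidable P → Dec (Σ (Tuple n) P)
  ∃? {n} P? with Any.any? P? (allTuples n)
  ... | yes found = yes (Any.satisfied found)
  ... | no none = no λ (x , px) → none (Any.map (λ { refl → px }) (∈-allTuples x))

  first : ∀ {A : Set} → (A → Bool) → List A → A → A
  first B [] default = default
  first B (e ∷ es) default = if B e then e else first B es default

  private
    skip : ∀ {A : Set} {B : A → Bool} {e es} →
           B e ≡ false → Any (λ x → B x ≡ true) (e ∷ es) → Any (λ x → B x ≡ true) es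
    skip Be≡false (here Be≡true) = contradiction (trans (sym Be≡false) Be≡true) λ ()
    skip Be≡false (there found) = found

  first-∈ : ∀ {A : Set} {B : A → Bool} {l default} → Any (λ x → B x ≡ true) l → B (first B l default) ≡ true
  first-∈ {B = B} {e ∷ es} found with B e in Be
  ... | true = Be
  ... | false = first-∈ (skip Be found)

  first-cong : ∀ {A : Set} {B B′ : A → Bool} {l default default′} → (∀ x → B x ≡ B′ x) →
               Any (λ x → B x ≡ true) l → first B l default ≡ first B′ l default′
  first-cong {B = B} {B′} {e ∷ es} B≗B′ found with B e in Be | B′ e in B′e
  ... | true  | true  = refl
  ... | false | false = first-cong B≗B′ (skip Be found)
  ... | true  | false = contradiction (trans (sym Be) (trans (B≗B′ e) B′e)) λ ()
  ... | false | true  = contradiction (trans (sym B′e) (trans (sym (B≗B′ e)) Be)) λ ()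

  -- The second argument is returned when B is empty.
  choose : ∀ {n} → Subset n → Tuple n → Tuple n
  choose {n} B = first B (allTuples n)

  choose-∈ : ∀ {n} {B : Subset n} {x} → x ∈ B → choose B x ∈ B
  choose-∈ {B = B} {x} x∈B = first-∈ {B = B} (Any.map (λ { refl → x∈B }) (∈-allTuples x))

  choose-cong : ∀ {n} {B B′ : Subset n} {x x′} → (∀ y → (y ∈ B) ⇔ (y ∈ B′)) → x ∈ B → choose B x ≡ choose B′ x′
  choose-cong {B = B} {B′} {x} B⇔B′ x∈B =
    first-cong {B = B} {B′} (λ y → Bool.⇔→≡ (B⇔B′ y)) (Any.map (λ { refl → x∈B }) (∈-allTuples x))

  module SchemeProperties {m : ℕ} {T : V → Set} {Π : Collection} (LS : IsLinearScheme m T Π) where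

    module _ {k} (r : InRange m k) where
      block-nonempty : ∀ {B} → Π k B → Σ (Tuple k) (_∈ B)
      block-nonempty = proj₁ (proj₁ LS k r) _

      block⊆Tᵏ : ∀ {B} → Π k B → ∀ {x} → x ∈ B → T ^ᵗ k ∋ x
      block⊆Tᵏ ΠB = proj₁ (proj₂ (proj₁ LS k r)) _ ΠB _

      cover : ∀ {x} → T ^ᵗ k ∋ x → Σ (Subset k) (λ B → Π k B × x ∈ B)
      cover = proj₁ (proj₂ (proj₂ (proj₁ LS k r))) _

      blocks-coincide : ∀ {B B′} → Π k B → Π k B′ → ∀ {x} → x ∈ B → x ∈ B′ → ∀ y → (y ∈ B) ⇔ (y ∈ B′)
      blocks-coincide ΠB ΠB′ = proj₂ (proj₂ (proj₂ (proj₁ LS k r))) _ _ ΠB ΠB′ _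

    module _ {a b} (ra : InRange m a) (rb : InRange m b) {B B′} (ΠB : Π a B) (ΠB′ : Π b B′) (c : Coef a b) where
      P1 : (B′ ≐ Img (τ c) B) ⊎ (∀ y → Img (τ c) B y → y ∈ B′ → ⊥)
      P1 = proj₁ (proj₂ LS a b ra rb B B′ ΠB ΠB′ c)

      P2 : ∀ {y y′} → y ∈ B′ → y′ ∈ B′ → Fibre (τ c) B y ↔ Fibre (τ c) B y′
      P2 = proj₂ (proj₂ LS a b ra rb B B′ ΠB ΠB′ c) _ _

    record MapsOnto {a b} (f : Tuple a → Tuple b) (B : Subset a) (B′ : Subset b) : Set where
      field
        into : ∀ {x} → x ∈ B → f x ∈ B′
        onto : ∀ {y} → y ∈ B′ → Img f B y

    ℳ-maps-block-onto : ∀ {a b} → InRange m a → InRange m b → ∀ {B B′} → Π a B → Π b B′ →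
                        ∀ {f : Tuple a → Tuple b} → ℳ f → ∀ {x₀} → x₀ ∈ B → f x₀ ∈ B′ → MapsOnto f B B′
    ℳ-maps-block-onto ra rb ΠB ΠB′ (c , τc≗f) {x₀} x₀∈B fx₀∈B′ with P1 ra rb ΠB ΠB′ c
    ... | inj₂ disjoint = ⊥-elim (disjoint _ (x₀ , x₀∈B , τc≗f x₀) fx₀∈B′)
    ... | inj₁ B′≐τcB = record
      { into = λ {x} x∈B → Equivalence.from (B′≐τcB _) (x , x∈B , τc≗f x)
      ; onto = λ {y} y∈B′ → let x , x∈B , τcx≡y = Equivalence.to (B′≐τcB y) y∈B′ in
                             x , x∈B , trans (sym (τc≗f x)) τcx≡y }

    P2-ℳ : ∀ {a b} → InRange m a → InRange m b → ∀ {B B′} → Π a B → Π b B′ →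
           ∀ {f : Tuple a → Tuple b} → ℳ f → ∀ {y y′} → y ∈ B′ → y′ ∈ B′ → Fibre f B y ↔ Fibre f B y′
    P2-ℳ ra rb ΠB ΠB′ {f} (c , τc≗f) y∈B′ y′∈B′ = retarget ↔-∘ (P2 ra rb ΠB ΠB′ c y∈B′ y′∈B′ ↔-∘ ↔-sym retarget)
      where
      retarget : ∀ {y} → Fibre (τ c) _ y ↔ Fibre f _ y
      retarget = mk↔ₛ′ (λ (x , x∈B , τcx≡y) → x , x∈B , trans (sym (τc≗f x)) τcx≡y)
                       (λ (x , x∈B , fx≡y) → x , x∈B , trans (τc≗f x) fx≡y)
                       (λ _ → fibre-≡ ≡-irrelevantᴮ refl) (λ _ → fibre-≡ ≡-irrelevantᴮ refl)

    -- Blocks are Boolean predicates that can only be compared extensionally. To glue the bijections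
    -- that (P2) gives on the blocks inside G, every point is sent to the block covering the first
    -- element (in the enumeration of Tuple n) of its own block, so points of one block share it.
    module UnionOfBlocks {n} (rn : InRange m n) (G : Tuple n → Set)
                         (G-irrelevant : ∀ {w} (g g′ : G w) → g ≡ g′)
                         (G⊆Tⁿ : ∀ {w} → G w → T ^ᵗ n ∋ w)
                         (G-saturated : ∀ {C} → Π n C → ∀ {w w′} → w ∈ C → w′ ∈ C → G w → G w′) where
      Block : Set
      Block = Σ (Subset n) (Π n)

      blockAt : ∀ {w} → G w → Block
      blockAt g = let C , ΠC , _ = cover rn (G⊆Tⁿ g) in C , ΠC

      ∈-blockAt : ∀ {w} (g : G w) → w ∈ proj₁ (blockAt g)
      ∈-blockAt g = proj₂ (proj₂ (cover rn (G⊆Tⁿ g)))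

      blockAt-cong : ∀ {w w′} → w ≡ w′ → (g : G w) (g′ : G w′) → blockAt g ≡ blockAt g′
      blockAt-cong refl g g′ = cong blockAt (G-irrelevant g g′)

      representative : ∀ w → G w → Tuple n
      representative w g = choose (proj₁ (blockAt g)) w

      ∈-representative : ∀ {w} (g : G w) → representative w g ∈ proj₁ (blockAt g)
      ∈-representative g = choose-∈ {B = proj₁ (blockAt g)} (∈-blockAt g)

      G-representative : ∀ {w} (g : G w) → G (representative w g)
      G-representative g = G-saturated (proj₂ (blockAt g)) (∈-blockAt g) (∈-representative g) g

      canonicalBlock : ∀ {w} → G w → Block
      canonicalBlock g = blockAt (G-representative g)

      ⇔-canonicalBlock : ∀ {w} (g : G w) y → (y ∈ proj₁ (blockAt g)) ⇔ (y ∈ proj₁ (canonicalBlock g))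
      ⇔-canonicalBlock g = blocks-coincide rn (proj₂ (blockAt g)) (proj₂ (canonicalBlock g))
                                          (∈-representative g) (∈-blockAt (G-representative g))

      ∈-canonicalBlock : ∀ {w} (g : G w) → w ∈ proj₁ (canonicalBlock g)
      ∈-canonicalBlock g = Equivalence.to (⇔-canonicalBlock g _) (∈-blockAt g)

      canonicalBlock-stable : ∀ {w w′} (g : G w) (g′ : G w′) →
                              w′ ∈ proj₁ (canonicalBlock g) → canonicalBlock g′ ≡ canonicalBlock g
      canonicalBlock-stable {w} {w′} g g′ w′∈K =
        blockAt-cong same-representative (G-representative g′) (G-representative g)
        where
        w′∈C : w′ ∈ proj₁ (blockAt g)
        w′∈C = Equivalence.from (⇔-canonicalBlock g w′) w′∈K
        same-representative : representative w′ g′ ≡ representative w g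
        same-representative =
          choose-cong (blocks-coincide rn (proj₂ (blockAt g′)) (proj₂ (blockAt g)) (∈-blockAt g′) w′∈C) (∈-blockAt g′)

      module _ {q} (f : Tuple n → Tuple q) where
        FibreG : Tuple q → Set
        FibreG y = Σ (Tuple n) (λ w → G w × f w ≡ y)

        move : ∀ {y₁ y₂} → (∀ {C} → Π n C → Fibre f C y₁ → Fibre f C y₂) → FibreG y₁ → FibreG y₂
        move F (w , g , fw≡y₁) =
          let w′ , w′∈K , fw′≡y₂ = F (proj₂ (canonicalBlock g)) (w , ∈-canonicalBlock g , fw≡y₁)
          in w′ , G-saturated (proj₂ (canonicalBlock g)) (∈-canonicalBlock g) w′∈K g , fw′≡y₂

        move-along : ∀ {y₁ y₂} (F : ∀ {C} → Π n C → Fibre f C y₁ → Fibre f C y₂) {K K′ : Block} → K′ ≡ K →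
                     (u : Fibre f (proj₁ K′) y₁) (v : Fibre f (proj₁ K) y₁) → proj₁ u ≡ proj₁ v →
                     proj₁ (F (proj₂ K′) u) ≡ proj₁ (F (proj₂ K) v)
        move-along F refl u v u≡v = cong (λ u → proj₁ (F _ u)) (fibre-≡ ≡-irrelevantᴮ u≡v)

        move-back : ∀ {y₁ y₂} (F : ∀ {C} → Π n C → Fibre f C y₁ ↔ Fibre f C y₂) →
                    ∀ u → move (λ ΠC → Inverse.from (F ΠC)) (move (λ ΠC → Inverse.to (F ΠC)) u) ≡ u
        move-back F u@(w , g , fw≡y₁) = fibre-≡ G-irrelevant (begin
          proj₁ (Inverse.from (F (proj₂ K′)) (w′ , ∈-canonicalBlock g′ , fw′≡y₂))
            ≡⟨ move-along (λ ΠC → Inverse.from (F ΠC)) (canonicalBlock-stable g g′ w′∈K) _ _ refl ⟩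
          proj₁ (Inverse.from (F (proj₂ K)) (Inverse.to (F (proj₂ K)) (w , ∈-canonicalBlock g , fw≡y₁)))
            ≡⟨ cong proj₁ (Inverse.strictlyInverseʳ (F (proj₂ K)) _) ⟩
          w ∎)
          where
          K = canonicalBlock g
          w′ = proj₁ (move (λ ΠC → Inverse.to (F ΠC)) u)
          g′ = proj₁ (proj₂ (move (λ ΠC → Inverse.to (F ΠC)) u))
          fw′≡y₂ = proj₂ (proj₂ (move (λ ΠC → Inverse.to (F ΠC)) u))
          K′ = canonicalBlock g′
          w′∈K = proj₁ (proj₂ (Inverse.to (F (proj₂ K)) (w , ∈-canonicalBlock g , fw≡y₁)))

        fibres-over-union : ∀ {y₁ y₂} → (∀ {C} → Π n C → Fibre f C y₁ ↔ Fibre f C y₂) → FibreG y₁ ↔ FibreG y₂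
        fibres-over-union F = mk↔ₛ′ (move (λ ΠC → Inverse.to (F ΠC))) (move (λ ΠC → Inverse.from (F ΠC)))
                                    (move-back (λ ΠC → ↔-sym (F ΠC))) (move-back F)

  module InducedScheme {m : ℕ} {S : V → Set} {Π : Collection}
                       (LS : IsLinearScheme m S Π) (SA : StronglyAntisymmetric m Π)
                       {k m′ : ℕ} (rk : InRange m k) {A : Subset k} (ΠA : Π k A) (bound : 2 * k * m′ ≤ m)
                       (σ-bij : BijOn σ A (σImage A)) where
    open SchemeProperties LS

    Π′ : Collection
    Π′ = Induced Π A

    pair-level : ∀ {i₁ i₂} → InRange m′ i₁ → InRange m′ i₂ → InRange m (i₁ * k + i₂ * k)
    pair-level {i₁} {i₂} (1≤i₁ , i₁≤m′) (_ , i₂≤m′) =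
      ℕ.≤-trans (ℕ.*-mono-≤ 1≤i₁ (proj₁ rk)) (ℕ.m≤m+n (i₁ * k) (i₂ * k)) , ℕ.≤-trans (m*o+n*o≤2*o*p i₁≤m′ i₂≤m′) bound

    level : ∀ {i} → InRange m′ i → InRange m (i * k)
    level {i} ri = ℕ.*-mono-≤ (proj₁ ri) (proj₁ rk) , ℕ.≤-trans (ℕ.m≤m+n (i * k) (i * k)) (proj₂ (pair-level ri ri))

    σ-injective : ∀ {a a′} → a ∈ A → a′ ∈ A → σ a ≡ σ a′ → a ≡ a′
    σ-injective = proj₁ (proj₂ σ-bij) _ _

    map-σ-injective : ∀ {i} {u u′ : Vec (Tuple k) i} → All (_∈ A) u → All (_∈ A) u′ → map σ u ≡ map σ u′ → u ≡ u′
    map-σ-injective [] [] _ = refl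
    map-σ-injective (a∈A ∷ u∈A) (a′∈A ∷ u′∈A) eq =
      cong₂ _∷_ (σ-injective a∈A a′∈A (Vec.∷-injectiveˡ eq)) (map-σ-injective u∈A u′∈A (Vec.∷-injectiveʳ eq))

    σ⁽⁾-injective : ∀ {i} {x x′ : Tuple (i * k)} → InPow A i x → InPow A i x′ → σ⁽ i ⁾ x ≡ σ⁽ i ⁾ x′ → x ≡ x′
    σ⁽⁾-injective {i} {x} {x′} x∈Aⁱ x′∈Aⁱ eq = begin
      x                             ≡⟨ concat-chunks i k x ⟨
      Vec.concat (chunks i k x)     ≡⟨ cong Vec.concat (map-σ-injective x∈Aⁱ x′∈Aⁱ eq) ⟩
      Vec.concat (chunks i k x′)    ≡⟨ concat-chunks i k x′ ⟩
      x′                            ∎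

    σ⁽⁾-bijective : ∀ {i} {B : Subset (i * k)} → (∀ x → x ∈ B → InPow A i x) → BijOn (σ⁽ i ⁾) B (Img (σ⁽ i ⁾) B)
    σ⁽⁾-bijective B⊆Aⁱ = (λ x x∈B → x , x∈B , refl)
                       , (λ x x′ x∈B x′∈B → σ⁽⁾-injective (B⊆Aⁱ x x∈B) (B⊆Aⁱ x′ x′∈B))
                       , (λ y y∈σB → y∈σB)

    Aⁱ⊆Sⁱᵏ : ∀ {i} {x : Tuple (i * k)} → InPow A i x → All S x
    Aⁱ⊆Sⁱᵏ {i} {x} x∈Aⁱ = subst (All S) (concat-chunks i k x) (Allₚ.concat⁺ (All.map (block⊆Tᵏ rk ΠA) x∈Aⁱ))

    block-⊆-Aⁱ : ∀ {i} → InRange m′ i → ∀ {B} → Π (i * k) B →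
                 ∀ {x} → x ∈ B → InPow A i x → ∀ x′ → x′ ∈ B → InPow A i x′
    block-⊆-Aⁱ {i} ri {B} ΠB {x} x∈B x∈Aⁱ x′ x′∈B = Allₚ.lookup⁻ λ j →
      subst (_∈ A) (sym (lookup-chunks i k x′ j)) (MapsOnto.into (chunk-onto j) x′∈B)
      where
      chunk-onto : ∀ j → MapsOnto (chunk j) B A
      chunk-onto j = ℳ-maps-block-onto (level ri) rk ΠB ΠA (ℳ-select _) x∈B
                       (subst (_∈ A) (lookup-chunks i k x j) (Allₚ.lookup⁺ x∈Aⁱ j))

    module _ {i} {S′ : Subset i} (p : Π′ i S′) where
      base : Subset (i * k)
      base = proj₁ p

      base-block : Π (i * k) base
      base-block = proj₁ (proj₂ p)

      base⊆Aⁱ : ∀ x → x ∈ base → InPow A i x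
      base⊆Aⁱ = proj₁ (proj₂ (proj₂ p))

      to-base : ∀ {y} → y ∈ S′ → Img (σ⁽ i ⁾) base y
      to-base = Equivalence.to (proj₂ (proj₂ (proj₂ p)) _)

      from-base : ∀ {x} → x ∈ base → σ⁽ i ⁾ x ∈ S′
      from-base x∈B = Equivalence.from (proj₂ (proj₂ (proj₂ p)) _) (_ , x∈B , refl)

    bases-coincide : ∀ {i} → InRange m′ i → ∀ {S S′} (p : Π′ i S) (p′ : Π′ i S′) →
                     ∀ {y} → y ∈ S → y ∈ S′ → ∀ x → (x ∈ base p) ⇔ (x ∈ base p′)
    bases-coincide ri p p′ y∈S y∈S′ =
      let x , x∈B , σx≡y = to-base p y∈S
          x′ , x′∈B′ , σx′≡y = to-base p′ y∈S′
          x≡x′ = σ⁽⁾-injective (base⊆Aⁱ p x x∈B) (base⊆Aⁱ p′ x′ x′∈B′) (trans σx≡y (sym σx′≡y))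
      in blocks-coincide (level ri) (base-block p) (base-block p′) x∈B (subst (_∈ base p′) (sym x≡x′) x′∈B′)

    σ-preimage : ∀ {i} {y : Tuple i} → All (σImage A) y → Σ (Vec (Tuple k) i) (λ u → All (_∈ A) u × map σ u ≡ y)
    σ-preimage [] = [] , [] , refl
    σ-preimage ((a , a∈A , σa≡y) ∷ y∈A′) =
      let u , u∈A , σu≡y = σ-preimage y∈A′ in a ∷ u , a∈A ∷ u∈A , cong₂ _∷_ σa≡y σu≡y

    image : ∀ {i} → Subset (i * k) → Subset i
    image {i} B y = ⌊ ∃? (λ x → (B x Bool.≟ true) ×-dec (σ⁽ i ⁾ x ≟ᵀ y)) ⌋

    image-≐ : ∀ {i} (B : Subset (i * k)) → image B ≐ Img (σ⁽ i ⁾) B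
    image-≐ B y = mk⇔ (λ y∈ → toWitness (Equivalence.from Bool.T-≡ y∈))
                      (λ y∈ → Equivalence.to Bool.T-≡ (fromWitness y∈))

    Π′-partition : ∀ i → InRange m′ i → IsPartition (σImage A) i (Π′ i)
    Π′-partition i ri = nonempty , ⊆A′ⁱ , covers , disjoint
      where
      nonempty : ∀ S′ → Π′ i S′ → Σ (Tuple i) (_∈ S′)
      nonempty S′ p = let x , x∈B = block-nonempty (level ri) (base-block p) in σ⁽ i ⁾ x , from-base p x∈B

      ⊆A′ⁱ : ∀ S′ → Π′ i S′ → ∀ y → y ∈ S′ → σImage A ^ᵗ i ∋ y
      ⊆A′ⁱ S′ p y y∈S′ = let x , x∈B , σx≡y = to-base p y∈S′ in
        subst (All (σImage A)) σx≡y (Allₚ.map⁺ (All.map (λ {a} a∈A → a , a∈A , refl) (base⊆Aⁱ p x x∈B)))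

      covers : ∀ y → σImage A ^ᵗ i ∋ y → Σ (Subset i) (λ S′ → Π′ i S′ × y ∈ S′)
      covers y y∈A′ⁱ =
        let u , u∈A , σu≡y = σ-preimage y∈A′ⁱ
            x∈Aⁱ = subst (All (_∈ A)) (sym (chunks-concat i k u)) u∈A
            B , ΠB , x∈B = cover (level ri) (Aⁱ⊆Sⁱᵏ x∈Aⁱ)
            σx≡y = trans (cong (map σ) (chunks-concat i k u)) σu≡y
        in image B , (B , ΠB , block-⊆-Aⁱ ri ΠB x∈B x∈Aⁱ , image-≐ B) , Equivalence.from (image-≐ B y) (_ , x∈B , σx≡y)

      disjoint : ∀ S₁ S₂ → Π′ i S₁ → Π′ i S₂ → ∀ y → y ∈ S₁ → y ∈ S₂ → ∀ y′ → (y′ ∈ S₁) ⇔ (y′ ∈ S₂)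
      disjoint S₁ S₂ p₁ p₂ y y∈S₁ y∈S₂ y′ =
        mk⇔ (transfer p₁ p₂ (bases-coincide ri p₁ p₂ y∈S₁ y∈S₂)) (transfer p₂ p₁ (bases-coincide ri p₂ p₁ y∈S₂ y∈S₁))
        where
        transfer : ∀ {S S′} (p : Π′ i S) (p′ : Π′ i S′) → (∀ x → (x ∈ base p) ⇔ (x ∈ base p′)) → y′ ∈ S → y′ ∈ S′
        transfer {S′ = S′} p p′ B⇔B′ y′∈S = let x , x∈B , σx≡y′ = to-base p y′∈S in
          subst (_∈ S′) σx≡y′ (from-base p′ (Equivalence.to (B⇔B′ x) x∈B))

    module Correspondence {i₁ i₂} (r₁ : InRange m′ i₁) (r₂ : InRange m′ i₂) (c : Coef i₁ i₂)
                {S₁ : Subset i₁} {S₂ : Subset i₂} (p₁ : Π′ i₁ S₁) (p₂ : Π′ i₂ S₂) where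
      n₁ n₂ n : ℕ
      n₁ = i₁ * k
      n₂ = i₂ * k
      n = n₁ + n₂

      rn : InRange m n
      rn = pair-level r₁ r₂

      t₁ t₂ : Tuple n → Tuple i₂
      t₁ w = τ c (σ⁽ i₁ ⁾ (Vec.take n₁ w))
      t₂ w = σ⁽ i₂ ⁾ (Vec.drop n₁ w)

      ℳ-t₁ : ℳ t₁
      ℳ-t₁ = ℳ-∘ (ℳ-∘ ℳ-take (ℳ-σ⁽⁾ i₁ k)) (c , λ _ → refl)

      ℳ-t₂ : ℳ t₂
      ℳ-t₂ = ℳ-∘ ℳ-drop (ℳ-σ⁽⁾ i₂ k)

      open Embedding n₁ i₂ k (Fin.fromℕ< (proj₁ rk))

      t₁∘embed≡𝟎 : ∀ v → t₁ (embed v) ≡ 𝟎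
      t₁∘embed≡𝟎 v = trans (cong (λ x → τ c (σ⁽ i₁ ⁾ x)) (take-embed v))
                           (ℳ-homo-𝟎 (ℳ-∘ (ℳ-σ⁽⁾ i₁ k) (c , λ _ → refl)))

      open Retraction ℳ-t₁ ℳ-t₂ ℳ-embed t₁∘embed≡𝟎 σ⁽⁾-drop-embed

      record Matched (w : Tuple n) : Set where
        constructor matched
        field
          take∈B₁ : Vec.take n₁ w ∈ base p₁
          drop∈B₂ : Vec.drop n₁ w ∈ base p₂
          equalized : t₁ w ≡ t₂ w

      Matched-irrelevant : ∀ {w} (g g′ : Matched w) → g ≡ g′
      Matched-irrelevant (matched l r e) (matched l′ r′ e′) =
        cong₃ matched (≡-irrelevantᴮ l l′) (≡-irrelevantᴮ r r′) (≡-irrelevantᵀ e e′)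
        where
        cong₃ : ∀ {A B C D : Set} (f : A → B → C → D) {a a′ b b′ c c′} →
                a ≡ a′ → b ≡ b′ → c ≡ c′ → f a b c ≡ f a′ b′ c′
        cong₃ f refl refl refl = refl

      Matched⊆Sⁿ : ∀ {w} → Matched w → All S w
      Matched⊆Sⁿ {w} (matched l r _) = subst (All S) (Vec.take++drop≡id n₁ w)
        (Allₚ.++⁺ (Aⁱ⊆Sⁱᵏ (base⊆Aⁱ p₁ _ l)) (Aⁱ⊆Sⁱᵏ (base⊆Aⁱ p₂ _ r)))

      matched-++ : ∀ {x z} → x ∈ base p₁ → z ∈ base p₂ → τ c (σ⁽ i₁ ⁾ x) ≡ σ⁽ i₂ ⁾ z → Matched (x ++ z)
      matched-++ {x} {z} x∈B₁ z∈B₂ eq = matched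
        (subst (_∈ base p₁) (sym (take-++ x z)) x∈B₁)
        (subst (_∈ base p₂) (sym (drop-++ x z)) z∈B₂)
        (subst₂ (λ x′ z′ → τ c (σ⁽ i₁ ⁾ x′) ≡ σ⁽ i₂ ⁾ z′) (sym (take-++ x z)) (sym (drop-++ x z)) eq)

      record MatchedBlock (C : Subset n) : Set where
        field
          block : Π n C
          equalizes : ∀ {w} → w ∈ C → t₁ w ≡ t₂ w
          take-onto : MapsOnto (Vec.take n₁) C (base p₁)
          drop-onto : MapsOnto (Vec.drop n₁) C (base p₂)

        all-matched : ∀ {w} → w ∈ C → Matched w
        all-matched w∈C = matched (MapsOnto.into take-onto w∈C) (MapsOnto.into drop-onto w∈C) (equalizes w∈C)

      matchedBlock : ∀ {C} → Π n C → ∀ {w₀} → w₀ ∈ C → Matched w₀ → MatchedBlock C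
      matchedBlock {C} ΠC {w₀} w₀∈C (matched l r e) = record
        { block = ΠC
        ; equalizes = λ w∈C → let w′ , _ , retract-w′≡w = MapsOnto.onto retract-onto w∈C in
                                subst (λ w → t₁ w ≡ t₂ w) retract-w′≡w (retract-equalizes w′)
        ; take-onto = ℳ-maps-block-onto rn (level r₁) ΠC (base-block p₁) ℳ-take w₀∈C l
        ; drop-onto = ℳ-maps-block-onto rn (level r₂) ΠC (base-block p₂) ℳ-drop w₀∈C r }
        where
        retract-onto : MapsOnto retract C C
        retract-onto = ℳ-maps-block-onto rn rn ΠC ΠC ℳ-retract w₀∈C (subst (_∈ C) (sym (retract-fixes w₀ e)) w₀∈C)

      matchedBlockAt : ∀ {w} → Matched w → Σ (Subset n) MatchedBlock
      matchedBlockAt g = let C , ΠC , w∈C = cover rn (Matched⊆Sⁿ g) in C , matchedBlock ΠC w∈C g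

      take-bijective : ∀ {C} → MatchedBlock C → BijOn (Vec.take n₁) C (_∈ base p₁)
      take-bijective {C} GC = (λ _ → into take-onto) , injective , (λ _ → onto take-onto)
        where
        open MatchedBlock GC
        open MapsOnto
        injective : ∀ w w′ → w ∈ C → w′ ∈ C → Vec.take n₁ w ≡ Vec.take n₁ w′ → w ≡ w′
        injective w w′ w∈C w′∈C take≡ = take-drop-injective take≡
          (σ⁽⁾-injective (base⊆Aⁱ p₂ _ (into drop-onto w∈C)) (base⊆Aⁱ p₂ _ (into drop-onto w′∈C))
            (trans (sym (equalizes w∈C)) (trans (cong (λ x → τ c (σ⁽ i₁ ⁾ x)) take≡) (equalizes w′∈C))))

      bijection-block : BijOn (τ c) S₁ (_∈ S₂) → Σ (Subset n) MatchedBlock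
      bijection-block (into , _ , _) =
        let x₀ , x₀∈B₁ = block-nonempty (level r₁) (base-block p₁)
            z₀ , z₀∈B₂ , σz₀≡τcσx₀ = to-base p₂ (into _ (from-base p₁ x₀∈B₁))
        in matchedBlockAt (matched-++ x₀∈B₁ z₀∈B₂ (sym σz₀≡τcσx₀))

      drop-bijective : (∀ s s′ → s ∈ S₁ → s′ ∈ S₁ → τ c s ≡ τ c s′ → s ≡ s′) →
                       ∀ {C} → MatchedBlock C → BijOn (Vec.drop n₁) C (_∈ base p₂)
      drop-bijective τc-injective {C} GC = (λ _ → into drop-onto) , injective , (λ _ → onto drop-onto)
        where
        open MatchedBlock GC
        open MapsOnto
        injective : ∀ w w′ → w ∈ C → w′ ∈ C → Vec.drop n₁ w ≡ Vec.drop n₁ w′ → w ≡ w′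
        injective w w′ w∈C w′∈C drop≡ = take-drop-injective
          (σ⁽⁾-injective (base⊆Aⁱ p₁ _ (into take-onto w∈C)) (base⊆Aⁱ p₁ _ (into take-onto w′∈C))
            (τc-injective _ _ (from-base p₁ (into take-onto w∈C)) (from-base p₁ (into take-onto w′∈C))
              (trans (equalizes w∈C) (trans (cong (σ⁽ i₂ ⁾) drop≡) (sym (equalizes w′∈C))))))
          drop≡

      open UnionOfBlocks rn Matched Matched-irrelevant Matched⊆Sⁿ
                         (λ ΠC w∈C w′∈C g → MatchedBlock.all-matched (matchedBlock ΠC w∈C g) w′∈C)
        public using (FibreG; fibres-over-union)

      fibre↔matched-fibre : ∀ {z y} → z ∈ base p₂ → σ⁽ i₂ ⁾ z ≡ y → Fibre (τ c) S₁ y ↔ FibreG (Vec.drop n₁) z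
      fibre↔matched-fibre {z} {y} z∈B₂ σz≡y = mk↔ₛ′ to from to∘from from∘to
        where
        to : Fibre (τ c) S₁ y → FibreG (Vec.drop n₁) z
        to (s , s∈S₁ , τcs≡y) = let x , x∈B₁ , σx≡s = to-base p₁ s∈S₁ in
          x ++ z , matched-++ x∈B₁ z∈B₂ (trans (cong (τ c) σx≡s) (trans τcs≡y (sym σz≡y))) , drop-++ x z
        from : FibreG (Vec.drop n₁) z → Fibre (τ c) S₁ y
        from (w , matched l _ e , drop≡z) =
          σ⁽ i₁ ⁾ (Vec.take n₁ w) , from-base p₁ l , trans e (trans (cong (σ⁽ i₂ ⁾) drop≡z) σz≡y)
        to∘from : ∀ u → to (from u) ≡ u
        to∘from (w , matched l r e , drop≡z) =
          let x , x∈B₁ , σx≡σtake = to-base p₁ (from-base p₁ l) in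
          fibre-≡ Matched-irrelevant (take-drop-injective
            (trans (take-++ x z) (σ⁽⁾-injective (base⊆Aⁱ p₁ x x∈B₁) (base⊆Aⁱ p₁ _ l) σx≡σtake))
            (trans (drop-++ x z) (sym drop≡z)))
        from∘to : ∀ u → from (to u) ≡ u
        from∘to (s , s∈S₁ , _) = let x , _ , σx≡s = to-base p₁ s∈S₁ in
          fibre-≡ ≡-irrelevantᴮ (trans (cong (σ⁽ i₁ ⁾) (take-++ x z)) σx≡s)

    Π′-P1 : ∀ {i₁ i₂} → InRange m′ i₁ → InRange m′ i₂ → ∀ {S₁ S₂} → Π′ i₁ S₁ → Π′ i₂ S₂ → (c : Coef i₁ i₂) →
            (S₂ ≐ Img (τ c) S₁) ⊎ (∀ y → Img (τ c) S₁ y → y ∈ S₂ → ⊥)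
    Π′-P1 {i₁} {i₂} r₁ r₂ {S₁} {S₂} p₁ p₂ c
      with ∃? (λ x → (base p₁ x Bool.≟ true) ×-dec (S₂ (τ c (σ⁽ i₁ ⁾ x)) Bool.≟ true))
    ... | no none = inj₂ λ y (s , s∈S₁ , τcs≡y) y∈S₂ → let x , x∈B₁ , σx≡s = to-base p₁ s∈S₁ in
      none (x , x∈B₁ , subst (_∈ S₂) (sym (trans (cong (τ c) σx≡s) τcs≡y)) y∈S₂)
    ... | yes (x₀ , x₀∈B₁ , τcσx₀∈S₂) = inj₁ λ y → mk⇔ to from
      where
      open Correspondence r₁ r₂ c p₁ p₂
      open MapsOnto
      z₀∈B₂ = proj₁ (proj₂ (to-base p₂ τcσx₀∈S₂))
      σz₀≡τcσx₀ = proj₂ (proj₂ (to-base p₂ τcσx₀∈S₂))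
      open MatchedBlock (proj₂ (matchedBlockAt (matched-++ x₀∈B₁ z₀∈B₂ (sym σz₀≡τcσx₀))))
      to : ∀ {y} → y ∈ S₂ → Img (τ c) S₁ y
      to y∈S₂ = let z , z∈B₂ , σz≡y = to-base p₂ y∈S₂
                    w , w∈C , drop≡z = onto drop-onto z∈B₂ in
        σ⁽ i₁ ⁾ (Vec.take n₁ w) , from-base p₁ (into take-onto w∈C)
                                , trans (equalizes w∈C) (trans (cong (σ⁽ i₂ ⁾) drop≡z) σz≡y)
      from : ∀ {y} → Img (τ c) S₁ y → y ∈ S₂
      from (s , s∈S₁ , τcs≡y) = let x , x∈B₁ , σx≡s = to-base p₁ s∈S₁
                                    w , w∈C , take≡x = onto take-onto x∈B₁ in
        subst (_∈ S₂) (trans (sym (equalizes w∈C))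
                             (trans (cong (λ x → τ c (σ⁽ i₁ ⁾ x)) take≡x) (trans (cong (τ c) σx≡s) τcs≡y)))
                      (from-base p₂ (into drop-onto w∈C))

    Π′-P2 : ∀ {i₁ i₂} → InRange m′ i₁ → InRange m′ i₂ → ∀ {S₁ S₂} → Π′ i₁ S₁ → Π′ i₂ S₂ → (c : Coef i₁ i₂) →
            ∀ {y y′} → y ∈ S₂ → y′ ∈ S₂ → Fibre (τ c) S₁ y ↔ Fibre (τ c) S₁ y′
    Π′-P2 r₁ r₂ p₁ p₂ c y∈S₂ y′∈S₂ =
      let z , z∈B₂ , σz≡y = to-base p₂ y∈S₂
          z′ , z′∈B₂ , σz′≡y′ = to-base p₂ y′∈S₂
      in ↔-sym (fibre↔matched-fibre z′∈B₂ σz′≡y′)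
           ↔-∘ (fibres-over-union (Vec.drop n₁) (λ ΠC → P2-ℳ rn (level r₂) ΠC (base-block p₂) ℳ-drop z∈B₂ z′∈B₂)
           ↔-∘ fibre↔matched-fibre z∈B₂ σz≡y)
      where open Correspondence r₁ r₂ c p₁ p₂

    Π′-linear-scheme : IsLinearScheme m′ (σImage A) Π′
    Π′-linear-scheme = Π′-partition , λ i₁ i₂ r₁ r₂ S₁ S₂ p₁ p₂ c → Π′-P1 r₁ r₂ p₁ p₂ c , λ _ _ → Π′-P2 r₁ r₂ p₁ p₂ c

    module Lifting {i₀} {S₀ : Subset i₀} (r₀ : InRange m′ i₀) (p₀ : Π′ i₀ S₀) where
      endpoint : ∀ {i} {S : Subset i} → Chain m′ Π′ S₀ i S → Π′ i S
      endpoint nil = p₀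
      endpoint (fwd _ _ p _ _) = p
      endpoint (bwd _ _ p _ _) = p

      endpoint-range : ∀ {i} {S : Subset i} → Chain m′ Π′ S₀ i S → InRange m′ i
      endpoint-range nil = r₀
      endpoint-range (fwd _ r _ _ _) = r
      endpoint-range (bwd _ r _ _ _) = r

      -- A step τ c : S → S′ becomes take⁻¹ followed by drop through a matched block (or the reverse).
      lift : ∀ {i} {S : Subset i} (ch : Chain m′ Π′ S₀ i S) → Chain m Π (base p₀) (i * k) (base (endpoint ch))
      lift nil = nil
      lift (fwd ch r p c b) =
        fwd (bwd (lift ch) rn block (proj₁ ℳ-take) (BijOn-ℳ ℳ-take (take-bijective GC)))
            (level r) (base-block p) (proj₁ ℳ-drop) (BijOn-ℳ ℳ-drop (drop-bijective (proj₁ (proj₂ b)) GC))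
        where
        open Correspondence (endpoint-range ch) r c (endpoint ch) p
        GC = proj₂ (bijection-block b)
        open MatchedBlock GC
      lift (bwd ch r p c b) =
        fwd (bwd (lift ch) rn block (proj₁ ℳ-drop) (BijOn-ℳ ℳ-drop (drop-bijective (proj₁ (proj₂ b)) GC)))
            (level r) (base-block p) (proj₁ ℳ-take) (BijOn-ℳ ℳ-take (take-bijective GC))
        where
        open Correspondence r (endpoint-range ch) c p (endpoint ch)
        GC = proj₂ (bijection-block b)
        open MatchedBlock GC

      lift-graph : ∀ {i} {S : Subset i} (ch : Chain m′ Π′ S₀ i S) → ∀ {s t} → Graph m′ Π′ ch s t →
                   ∀ {x} → x ∈ base p₀ → σ⁽ i₀ ⁾ x ≡ s →
                   Σ (Tuple (i * k)) (λ u → Graph m Π (lift ch) x u × u ∈ base (endpoint ch) × σ⁽ i ⁾ u ≡ t)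
      lift-graph nil gnil x∈B σx≡s = _ , gnil , x∈B , σx≡s
      lift-graph (fwd {i} {i′} ch r p c b) (gfwd g) x∈B σx≡s =
        let u₀ , G₀ , u₀∈B , σu₀≡t₀ = lift-graph ch g x∈B σx≡s
            w , w∈C , take≡u₀ = MapsOnto.onto take-onto u₀∈B
        in τ (proj₁ ℳ-drop) w
         , gfwd (gbwd G₀ w∈C (trans (proj₂ ℳ-take w) take≡u₀))
         , subst (_∈ base p) (sym (proj₂ ℳ-drop w)) (MapsOnto.into drop-onto w∈C)
         , trans (cong (σ⁽ i′ ⁾) (proj₂ ℳ-drop w))
                 (trans (sym (equalizes w∈C)) (cong (τ c) (trans (cong (σ⁽ i ⁾) take≡u₀) σu₀≡t₀)))
        where
        open Correspondence (endpoint-range ch) r c (endpoint ch) p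
        open MatchedBlock (proj₂ (bijection-block b))
      lift-graph (bwd {i} {i′} ch r p c b) (gbwd g t∈S τct≡t₀) x∈B σx≡s =
        let u₀ , G₀ , u₀∈B , σu₀≡t₀ = lift-graph ch g x∈B σx≡s
            w , w∈C , drop≡u₀ = MapsOnto.onto drop-onto u₀∈B
            take-w∈B = MapsOnto.into take-onto w∈C
        in τ (proj₁ ℳ-take) w
         , gfwd (gbwd G₀ w∈C (trans (proj₂ ℳ-drop w) drop≡u₀))
         , subst (_∈ base p) (sym (proj₂ ℳ-take w)) take-w∈B
         , trans (cong (σ⁽ i′ ⁾) (proj₂ ℳ-take w))
                 (proj₁ (proj₂ b) _ _ (from-base p take-w∈B) t∈S
                   (trans (equalizes w∈C) (trans (cong (σ⁽ i ⁾) drop≡u₀) (trans σu₀≡t₀ (sym τct≡t₀)))))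
        where
        open Correspondence r (endpoint-range ch) c p (endpoint ch)
        open MatchedBlock (proj₂ (bijection-block b))

    Π′-strongly-antisymmetric : StronglyAntisymmetric m′ Π′
    Π′-strongly-antisymmetric i S₀ r₀ p₀ ch s t s∈S₀ g =
      let x , x∈B₀ , σx≡s = to-base p₀ s∈S₀
          u , G , u∈B , σu≡t = lift-graph ch g x∈B₀ σx≡s
          x≡u = SA (i * k) (base p₀) (level r₀) (base-block p₀) closed x _ x∈B₀ (gfwd G)
      in trans (sym σx≡s) (trans (cong (σ⁽ i ⁾) (trans x≡u (proj₂ ℳ-id u))) σu≡t)
      where
      open Lifting r₀ p₀
      -- endpoint ch and p₀ may be different witnesses for S₀ whose bases agree only extensionally,
      -- hence the closing identity step.
      closed : Chain m Π (base p₀) (i * k) (base p₀)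
      closed = fwd (lift ch) (level r₀) (base-block p₀) (proj₁ ℳ-id) (BijOn-ℳ ℳ-id identity)
        where
        same : ∀ x → (x ∈ base (endpoint ch)) ⇔ (x ∈ base p₀)
        same = bases-coincide r₀ (endpoint ch) p₀ s∈S₀ s∈S₀
        identity : BijOn (λ x → x) (base (endpoint ch)) (_∈ base p₀)
        identity = (λ x → Equivalence.to (same x))
                 , (λ _ _ _ _ eq → eq)
                 , (λ x x∈B₀ → x , Equivalence.from (same x) x∈B₀ , refl)

lemma4p7 : (𝔽 : FiniteField) (d : ℕ) → let open Scheme 𝔽 d in
  (m : ℕ) (S : V → Set) (Π : Collection) →
  IsLinearScheme m S Π → StronglyAntisymmetric m Π →
  (k m' : ℕ) → InRange m k → InRange m m' →
  (A : Subset k) → Π k A → 2 * k * m' ≤ m →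
  BijOn σ A (σImage A) →
    ( IsLinearScheme m' (σImage A) (Induced Π A)
    × StronglyAntisymmetric m' (Induced Π A)
    × (∀ i → InRange m' i → ∀ B → Π (i * k) B → (∀ x → x ∈ B → InPow A i x) →
         BijOn (σ⁽ i ⁾) B (Img (σ⁽ i ⁾) B)) )
-- The hypothesis m′ ≤ m is implied by 2km′ ≤ m and not used.
lemma4p7 𝔽 d m S Π LS SA k m′ rk _ A ΠA bound σ-bij =
  Π′-linear-scheme , Π′-strongly-antisymmetric , λ i _ B _ → σ⁽⁾-bijective
  where open InducedScheme 𝔽 d LS SA rk ΠA bound σ-bij
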